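{- Let $(\mathcal{U},F)$ be a unifiable second-order ground unification (SOGU) problem whose only function variable is $F$, where $F$ has arity $n$, let $h_1,\ldots,h_n\geq 0$ be non-negative integers, and let $\sigma=\{F\mapsto\lambda x_1\ldots x_n.s\}$ be a unifier of $(\mathcal{U},F)$ such that the individual variables of $s$ are among $x_1,\ldots,x_n$ and $\mathit{occ}_\Sigma(x_i,s)=h_i$ for all $1\leq i\leq n$. Then for all $g\in\Sigma$, $$\mathit{occ}_\Sigma(g,s)\cdot\bigl(\mathrm{mul}[F,\overline{h_n},\mathcal{U}]_l-\mathrm{mul}[F,\overline{h_n},\mathcal{U}]_r\bigr)=\mathrm{cnt}[F,\overline{h_n},g,\mathcal{U}]_r-\mathrm{cnt}[F,\overline{h_n},g,\mathcal{U}]_l.$$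
   Context: $\Sigma$ is a signature of function symbols with fixed arities (arity $0$ symbols are constants). Terms are built from $\Sigma$, individual variables, and function variables; a function variable of arity $n$ is applied to $n$ argument terms. A second-order ground term is a term with no individual variables and containing at least one function variable, all its function variables having the same arity. $\overline{h_n}$ abbreviates $h_1,\ldots,h_n$. $\mathit{occ}_\Sigma(c,t)$ is the number of occurrences of the symbol or variable $c$ in the term $t$. An SOGU problem $(\mathcal{U},F)$ consists of a function variable $F$ of arity $n>0$ and a finite set $\mathcal{U}$ of equations $u\stackrel{?}{=}_F v$ between second-order ground terms in each of which $F$ is the only function variable. A unifier is a substitution $\sigma=\{F\mapsto\lambda x_1\ldots x_n.s\}$, with $s$ containing no function variables, such that $u\sigma=v\sigma$ (syntactically) for every $u\stackrel{?}{=}_F v$ in $\mathcal{U}$; the problem is unifiable if it has a unifier. $t\sigma$ is taken in $\beta$-normal form: $F(t_1,\ldots,t_n)\sigma$ is the result of simultaneously replacing each $x_i$ in $s$ by $t_i\sigma$, and $f(t_1,\ldots,t_l)\sigma=f(t_1\sigma,\ldots,t_l\sigma)$ for $f\in\Sigma$. The following are defined recursively on terms $t$ with no individual variables and no function variable other than $F$. $n$-multiplier $\mathrm{mul}[F,\overline{h_n},t]$: it is $0$ if $t$ is a constant; $\mathrm{mul}[F,\overline{h_n},f(t_1,\ldots,t_l)]=\sum_{j=1}^l\mathrm{mul}[F,\overline{h_n},t_j]$ for $f\in\Sigma$; $\mathrm{mul}[F,\overline{h_n},F(t_1,\ldots,t_n)]=1+\sum_{i=1}^n h_i\cdot\mathrm{mul}[F,\overline{h_n},t_i]$.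 $n$-counter $\mathrm{cnt}[F,\overline{h_n},g,t]$ for $g\in\Sigma$: for $f\in\Sigma$ of arity $l\geq 0$, $\mathrm{cnt}[F,\overline{h_n},g,f(t_1,\ldots,t_l)]=\delta+\sum_{j=1}^l\mathrm{cnt}[F,\overline{h_n},g,t_j]$, where $\delta=1$ if $f=g$ and $\delta=0$ otherwise; $\mathrm{cnt}[F,\overline{h_n},g,F(t_1,\ldots,t_n)]=\sum_{i=1}^n h_i\cdot\mathrm{cnt}[F,\overline{h_n},g,t_i]$. For a problem $(\mathcal{U},F)$: $\mathrm{mul}[F,\overline{h_n},\mathcal{U}]_l$ and $\mathrm{mul}[F,\overline{h_n},\mathcal{U}]_r$ are the sums over all $u\stackrel{?}{=}_F v$ in $\mathcal{U}$ of $\mathrm{mul}[F,\overline{h_n},u]$ and of $\mathrm{mul}[F,\overline{h_n},v]$, respectively; $\mathrm{cnt}[F,\overline{h_n},g,\mathcal{U}]_l$ and $\mathrm{cnt}[F,\overline{h_n},g,\mathcal{U}]_r$ are the sums over all $u\stackrel{?}{=}_F v$ in $\mathcal{U}$ of $\mathrm{cnt}[F,\overline{h_n},g,u]$ and of $\mathrm{cnt}[F,\overline{h_n},g,v]$, respectively. -}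

module Defs where

open import Data.Bool using (if_then_else_)
open import Data.Empty using (⊥)
open import Data.List using (List; map)
open import Data.List.Relation.Unary.All using (All)
open import Data.List.Relation.Unary.Unique.Propositional using (Unique)
open import Data.Nat using (ℕ; _+_; _*_; _<_)
import Data.Nat as ℕ
import Data.Nat.ListAction as List
open import Data.Product using (∃; _×_)
open import Data.Unit using (⊤; tt)
import Data.Unit.Properties as ⊤
open import Data.Vec using (Vec; []; _∷_; sum; zipWith)
open import Data.Vec.Membership.Propositional using (_∈_)
import Data.Vec.Relation.Unary.Unique.Propositional as VecUnique
open import Relation.Binary.Definitions using (DecidableEquality)
open import Relation.Binary.PropositionalEquality using (_≡_)
open import Relation.Nullary using (does)

-- Used both for the function symbols and for the function variables of a
-- term language.  Decidable equality is what makes counting occurrences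
-- computable.
record Signature : Set₁ where
  field
    Sym   : Set
    arity : Sym → ℕ
    _≟_   : DecidableEquality Sym

open Signature public using (Sym; arity)

noFunVars : Signature
noFunVars = record { Sym = ⊥ ; arity = λ () ; _≟_ = λ () }

-- The one function variable F, of arity n.
onlyF : ℕ → Signature
onlyF n = record { Sym = ⊤ ; arity = λ _ → n ; _≟_ = ⊤._≟_ }

-- Terms with function symbols from S, function variables from Φ and
-- individual variables from X.
data Term (S Φ : Signature) (X : Set) : Set where
  var : X → Term S Φ X
  fun : (f : Sym S) → Vec (Term S Φ X) (arity S f) → Term S Φ X
  app : (G : Sym Φ) → Vec (Term S Φ X) (arity Φ G) → Term S Φ X

IndVar : Set
IndVar = ℕ

FirstOrderTerm : Signature → Set
FirstOrderTerm S = Term S noFunVars IndVar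

-- No individual variables, and no function variable other than F (of arity n).
-- That F does occur is imposed separately, in SOGU: subterms need not contain F.
FTerm : Signature → ℕ → Set
FTerm S n = Term S (onlyF n) ⊥

δ : {A : Set} → DecidableEquality A → A → A → ℕ
δ _≟_ a b = if does (a ≟ b) then 1 else 0

module _ {S Φ : Signature} {X : Set} where

  -- Number of nodes of a term, each weighted according to its label.
  count : (Sym S → ℕ) → (Sym Φ → ℕ) → (X → ℕ) → Term S Φ X → ℕ
  counts : (Sym S → ℕ) → (Sym Φ → ℕ) → (X → ℕ) →
           ∀ {k} → Vec (Term S Φ X) k → Vec ℕ k
  count a b c (var x)    = c x
  count a b c (fun f ts) = a f + sum (counts a b c ts)
  count a b c (app G ts) = b G + sum (counts a b c ts)
  counts a b c []       = []
  counts a b c (t ∷ ts) = count a b c t ∷ counts a b c ts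

  occSym : Sym S → Term S Φ X → ℕ
  occSym g = count (δ (Signature._≟_ S) g) (λ _ → 0) (λ _ → 0)

  occFunVar : Sym Φ → Term S Φ X → ℕ
  occFunVar G = count (λ _ → 0) (δ (Signature._≟_ Φ) G) (λ _ → 0)

occVar : ∀ {S Φ} → IndVar → Term S Φ IndVar → ℕ
occVar x = count (λ _ → 0) (λ _ → 0) (δ ℕ._≟_ x)

SecondOrderGround : ∀ {S n} → FTerm S n → Set
SecondOrderGround t = 0 < occFunVar tt t

record Equation (S : Signature) (n : ℕ) : Set where
  constructor _≟F_
  field
    lhs rhs : FTerm S n

open Equation public

-- The finite set of equations is a list without repetitions.
record SOGU (S : Signature) (n : ℕ) : Set where
  field
    arity>0   : 0 < n
    equations : List (Equation S n)
    distinct  : Unique equations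
    ground    : All (λ e → SecondOrderGround (lhs e) × SecondOrderGround (rhs e))
                    equations

open SOGU public

-- The substitution {F ↦ λ x₁ … xₙ . s}.  The body may contain individual
-- variables other than the xᵢ.
record Substitution (S : Signature) (n : ℕ) : Set where
  field
    params   : Vec IndVar n
    distinct : VecUnique.Unique params
    body     : FirstOrderTerm S

open Substitution public using (params; body)

module _ {S : Signature} where

  assign : ∀ {n} → Vec IndVar n → Vec (FirstOrderTerm S) n →
           IndVar → FirstOrderTerm S
  assign []       []       y = var y
  assign (x ∷ xs) (t ∷ ts) y = if does (x ℕ.≟ y) then t else assign xs ts y

  replace : (IndVar → FirstOrderTerm S) → FirstOrderTerm S → FirstOrderTerm S
  replaces : (IndVar → FirstOrderTerm S) →
             ∀ {k} → Vec (FirstOrderTerm S) k → Vec (FirstOrderTerm S) k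
  replace ρ (var x)    = ρ x
  replace ρ (fun f ts) = fun f (replaces ρ ts)
  replaces ρ []       = []
  replaces ρ (t ∷ ts) = replace ρ t ∷ replaces ρ ts

  -- t [ σ ] is the β-normal form of tσ.
  infix 8 _[_] _[_]*
  _[_] : ∀ {n} → FTerm S n → Substitution S n → FirstOrderTerm S
  _[_]* : ∀ {n k} → Vec (FTerm S n) k → Substitution S n →
          Vec (FirstOrderTerm S) k
  fun f ts [ σ ] = fun f (ts [ σ ]*)
  app _ ts [ σ ] = replace (assign (params σ) (ts [ σ ]*)) (body σ)
  []       [ σ ]* = []
  (t ∷ ts) [ σ ]* = t [ σ ] ∷ ts [ σ ]*

module _ {S : Signature} {n : ℕ} where

  IsUnifier : SOGU S n → Substitution S n → Set
  IsUnifier U σ = All (λ e → lhs e [ σ ] ≡ rhs e [ σ ]) (equations U)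

  Unifiable : SOGU S n → Set
  Unifiable U = ∃ (IsUnifier U)

  VarsAmongParams : Substitution S n → Set
  VarsAmongParams σ = ∀ y → 0 < occVar y (body σ) → y ∈ params σ

  -- The clause for constants is the case of an empty argument vector.
  mul : Vec ℕ n → FTerm S n → ℕ
  muls : Vec ℕ n → ∀ {k} → Vec (FTerm S n) k → Vec ℕ k
  mul h (fun f ts) = sum (muls h ts)
  mul h (app _ ts) = 1 + sum (zipWith _*_ h (muls h ts))
  muls h []       = []
  muls h (t ∷ ts) = mul h t ∷ muls h ts

  cnt : Vec ℕ n → Sym S → FTerm S n → ℕ
  cnts : Vec ℕ n → Sym S → ∀ {k} → Vec (FTerm S n) k → Vec ℕ k
  cnt h g (fun f ts) = δ (Signature._≟_ S) g f + sum (cnts h g ts)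
  cnt h g (app _ ts) = sum (zipWith _*_ h (cnts h g ts))
  cnts h g []       = []
  cnts h g (t ∷ ts) = cnt h g t ∷ cnts h g ts

  mulₗ mulᵣ : Vec ℕ n → SOGU S n → ℕ
  mulₗ h U = List.sum (map (λ e → mul h (lhs e)) (equations U))
  mulᵣ h U = List.sum (map (λ e → mul h (rhs e)) (equations U))

  cntₗ cntᵣ : Vec ℕ n → Sym S → SOGU S n → ℕ
  cntₗ h g U = List.sum (map (λ e → cnt h g (lhs e)) (equations U))
  cntᵣ h g U = List.sum (map (λ e → cnt h g (rhs e)) (equations U))

{-# OPTIONS --safe #-}

-- Occurrences of g are counted through the substitution: for
-- σ = {F ↦ λ x₁ … xₙ . s} with occ(xᵢ, s) = hᵢ, every F-term t satisfies
--
--   occ(g, tσ) = occ(g, s) · mul(t) + cnt(g, t).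
--
-- Each equation u ≟ v of the problem has uσ = vσ; summing the resulting
-- identities over all equations and rearranging in ℤ gives the theorem.
module Submission where

open import Defs
open import Data.Fin using (Fin)
open import Data.Integer using (+_; _-_; _*_)
open import Data.Nat using (ℕ)
open import Data.Vec using (Vec; lookup)
open import Relation.Binary.PropositionalEquality using (_≡_)

open import Data.Integer using (ℤ)
import Data.Integer as ℤ
import Data.Integer.Properties as ℤ
open import Data.Integer.Tactic.RingSolver using () renaming (solve-∀ to ℤ-solve-∀)
open import Data.List using (List; []; _∷_)
import Data.List as List
import Data.Nat.ListAction as ListAction
open import Data.List.Relation.Unary.All using (All; []; _∷_)
open import Data.Nat using (_+_)
import Data.Nat as ℕ
import Data.Nat.Properties as ℕ
open import Data.Nat.Tactic.RingSolver using (solve-∀)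
open import Data.Vec using ([]; _∷_; sum; zipWith; map)
open import Data.Vec.Properties using (lookup-map; tabulate∘lookup; tabulate-cong)
open import Data.Vec.Relation.Unary.All using ([]; _∷_) renaming (All to VecAll)
open import Data.Vec.Relation.Unary.AllPairs using ([]; _∷_)
open import Data.Vec.Relation.Unary.Unique.Propositional using (Unique)
open import Relation.Binary.PropositionalEquality
  using (_≢_; ≢-sym; refl; sym; trans; cong; cong₂; module ≡-Reasoning)
open import Relation.Nullary using (yes; no)
open import Relation.Nullary.Decidable using (dec-true; dec-false)

lookup-ext : ∀ {A : Set} {n} {xs ys : Vec A n} →
             (∀ i → lookup xs i ≡ lookup ys i) → xs ≡ ys
lookup-ext {xs = xs} {ys} eq =
  trans (sym (tabulate∘lookup xs)) (trans (tabulate-cong eq) (tabulate∘lookup ys))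

module _ {S Φ : Signature} {X : Set} where

  -- The weight `δ ℕ._≟_ x` gives `occVar x`. Other weights are needed because a variable
  -- occurrence, once replaced, contributes all the symbols of its replacement.
  varCount : (X → ℕ) → Term S Φ X → ℕ
  varCount = count (λ _ → 0) (λ _ → 0)

  varCounts : (X → ℕ) → ∀ {k} → Vec (Term S Φ X) k → Vec ℕ k
  varCounts = counts (λ _ → 0) (λ _ → 0)

  varCount-zero : ∀ t → varCount (λ _ → 0) t ≡ 0
  varCounts-zero : ∀ {k} (ts : Vec (Term S Φ X) k) → sum (varCounts (λ _ → 0) ts) ≡ 0
  varCount-zero (var x)    = refl
  varCount-zero (fun f ts) = varCounts-zero ts
  varCount-zero (app G ts) = varCounts-zero ts
  varCounts-zero []       = refl
  varCounts-zero (t ∷ ts) = cong₂ _+_ (varCount-zero t) (varCounts-zero ts)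

  module _ {a b c : X → ℕ} (k : ℕ) (eq : ∀ x → c x ≡ a x ℕ.* k + b x) where

    -- Each variable occurrence adds its weight independently of the others, so a linear relation
    -- between weights carries over to terms. This lets `varCount-assign` split off one parameter at
    -- a time.
    varCount-linear : ∀ t → varCount c t ≡ varCount a t ℕ.* k + varCount b t
    varCounts-linear : ∀ {l} (ts : Vec (Term S Φ X) l) →
      sum (varCounts c ts) ≡ sum (varCounts a ts) ℕ.* k + sum (varCounts b ts)
    varCount-linear (var x)    = eq x
    varCount-linear (fun f ts) = varCounts-linear ts
    varCount-linear (app G ts) = varCounts-linear ts
    varCounts-linear []       = refl
    varCounts-linear (t ∷ ts) =
      trans (cong₂ _+_ (varCount-linear t) (varCounts-linear ts))
            (rearrange (varCount a t) (varCount b t) (sum (varCounts a ts)) _ k)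
      where
      rearrange : ∀ a b as bs k →
        (a ℕ.* k + b) + (as ℕ.* k + bs) ≡ (a + as) ℕ.* k + (b + bs)
      rearrange = solve-∀

module _ (S : Signature) (g : Sym S) where

  occSyms : ∀ {k} → Vec (FirstOrderTerm S) k → Vec ℕ k
  occSyms = counts (δ (Signature._≟_ S) g) (λ _ → 0) (λ _ → 0)

  -- Replacement keeps the function symbols of `s` and turns each occurrence of a variable `y` into
  -- a copy of `ρ y`.
  occSym-replace : ∀ ρ (s : FirstOrderTerm S) →
    occSym g (replace ρ s) ≡ occSym g s + varCount (λ y → occSym g (ρ y)) s
  occSyms-replaces : ∀ ρ {k} (ss : Vec (FirstOrderTerm S) k) →
    sum (occSyms (replaces ρ ss)) ≡
    sum (occSyms ss) + sum (varCounts (λ y → occSym g (ρ y)) ss)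
  occSym-replace ρ (var x)    = refl
  occSym-replace ρ (fun f ss) =
    trans (cong (d ℕ.+_) (occSyms-replaces ρ ss)) (sym (ℕ.+-assoc d _ _))
    where d = δ (Signature._≟_ S) g f
  occSyms-replaces ρ []       = refl
  occSyms-replaces ρ (s ∷ ss) =
    trans (cong₂ _+_ (occSym-replace ρ s) (occSyms-replaces ρ ss))
          (rearrange (occSym g s) _ (sum (occSyms ss)) _)
    where
    rearrange : ∀ a b c d → (a + b) + (c + d) ≡ (a + c) + (b + d)
    rearrange = solve-∀

  occSym-assign-∉ : ∀ {n y} {xs : Vec IndVar n} → VecAll (y ≢_) xs →
                    (ts : Vec (FirstOrderTerm S) n) → occSym g (assign xs ts y) ≡ 0
  occSym-assign-∉                []        []       = refl
  occSym-assign-∉ {y = y} {x ∷ _} (y≢x ∷ y∉) (t ∷ ts)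
    rewrite dec-false (x ℕ.≟ y) (≢-sym y≢x) = occSym-assign-∉ y∉ ts

  -- Distinctness of the parameters makes the two cases add up: at `y = x` the later parameters do
  -- not match, so the last summand vanishes; elsewhere the `δ` does.
  occSym-assign-∷ : ∀ {n x} {xs : Vec IndVar n} → VecAll (x ≢_) xs →
    (t : FirstOrderTerm S) (ts : Vec (FirstOrderTerm S) n) → ∀ y →
    occSym g (assign (x ∷ xs) (t ∷ ts) y) ≡
    δ ℕ._≟_ x y ℕ.* occSym g t + occSym g (assign xs ts y)
  occSym-assign-∷ {x = x} x∉ t ts y with x ℕ.≟ y
  ... | no  x≢y  rewrite dec-false (x ℕ.≟ y) x≢y = refl
  ... | yes refl rewrite dec-true (x ℕ.≟ x) refl =
    sym (trans (cong₂ _+_ (ℕ.*-identityˡ _) (occSym-assign-∉ x∉ ts)) (ℕ.+-identityʳ _))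

  varCount-assign : ∀ {n} {xs : Vec IndVar n} → Unique xs →
    (ts : Vec (FirstOrderTerm S) n) (s : FirstOrderTerm S) →
    varCount (λ y → occSym g (assign xs ts y)) s ≡
    sum (zipWith ℕ._*_ (map (λ x → occVar x s) xs) (occSyms ts))
  varCount-assign              []          []       s = varCount-zero s
  varCount-assign {xs = x ∷ _} (x∉ ∷ uniq) (t ∷ ts) s =
    -- The coefficient of `occSym g t` is the count with weight `δ ℕ._≟_ x`, which is `occVar x s`
    -- by definition.
    trans (varCount-linear (occSym g t) (occSym-assign-∷ x∉ t ts) s)
          (cong (occVar x s ℕ.* occSym g t ℕ.+_) (varCount-assign uniq ts s))

module _ {S : Signature} {n : ℕ} (h : Vec ℕ n) (σ : Substitution S n)
         (occ≡h : ∀ i → occVar (lookup (params σ) i) (body σ) ≡ lookup h i)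
         (g : Sym S) where

  private
    o : ℕ
    o = occSym g (body σ)

    *+-distrib : ∀ o m c ms cs →
      (o ℕ.* m + c) + (o ℕ.* ms + cs) ≡ o ℕ.* (m + ms) + (c + cs)
    *+-distrib = solve-∀

  occVars≡h : map (λ x → occVar x (body σ)) (params σ) ≡ h
  occVars≡h = lookup-ext λ i → trans (lookup-map i _ (params σ)) (occ≡h i)

  -- Beta-reduction yields one copy of the body, with the i-th instantiated argument copied once for
  -- each occurrence of the i-th parameter, hence `lookup h i` times.
  occSym-app : ∀ ts → occSym g (app _ ts [ σ ]) ≡
                      o + sum (zipWith ℕ._*_ h (occSyms S g (ts [ σ ]*)))
  occSym-app ts = begin
    occSym g (replace (assign (params σ) ts′) (body σ))
      ≡⟨ occSym-replace S g _ (body σ) ⟩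
    o + varCount (λ y → occSym g (assign (params σ) ts′ y)) (body σ)
      ≡⟨ cong (o ℕ.+_) (varCount-assign S g (Substitution.distinct σ) ts′ (body σ)) ⟩
    o + sum (zipWith ℕ._*_ (map (λ x → occVar x (body σ)) (params σ)) (occSyms S g ts′))
      ≡⟨ cong (λ v → o + sum (zipWith ℕ._*_ v (occSyms S g ts′))) occVars≡h ⟩
    o + sum (zipWith ℕ._*_ h (occSyms S g ts′)) ∎
    where
    open ≡-Reasoning
    ts′ = ts [ σ ]*

  occSym-[] : ∀ t → occSym g (t [ σ ]) ≡ o ℕ.* mul h t + cnt h g t
  occSyms-[] : ∀ {k} (ts : Vec (FTerm S n) k) →
    sum (occSyms S g (ts [ σ ]*)) ≡ o ℕ.* sum (muls h ts) + sum (cnts h g ts)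
  -- The weights `w` are kept apart from `h` so that they can shrink with the argument vector, while
  -- `mul` and `cnt` still use all of `h`.
  occSyms-[]-weighted : ∀ {k} (w : Vec ℕ k) (ts : Vec (FTerm S n) k) →
    sum (zipWith ℕ._*_ w (occSyms S g (ts [ σ ]*))) ≡
    o ℕ.* sum (zipWith ℕ._*_ w (muls h ts)) + sum (zipWith ℕ._*_ w (cnts h g ts))

  occSym-[] (fun f ts) =
    trans (cong (d ℕ.+_) (occSyms-[] ts)) (rearrange d (o ℕ.* sum (muls h ts)) _)
    where
    d = δ (Signature._≟_ S) g f
    rearrange : ∀ d m c → d + (m + c) ≡ m + (d + c)
    rearrange = solve-∀
  -- The lone `o`, from the copy of the body replacing this `F`, becomes the `1 +` in the clause of
  -- `mul`.
  occSym-[] (app _ ts) =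
    trans (occSym-app ts)
      (trans (cong (o ℕ.+_) (occSyms-[]-weighted h ts))
             (rearrange o (sum (zipWith ℕ._*_ h (muls h ts))) _))
    where
    rearrange : ∀ o m c → o + (o ℕ.* m + c) ≡ o ℕ.* (1 + m) + c
    rearrange = solve-∀

  occSyms-[] []       = sym (trans (ℕ.+-identityʳ _) (ℕ.*-zeroʳ o))
  occSyms-[] (t ∷ ts) =
    trans (cong₂ _+_ (occSym-[] t) (occSyms-[] ts))
          (*+-distrib o (mul h t) (cnt h g t) (sum (muls h ts)) _)

  occSyms-[]-weighted []       []       = sym (trans (ℕ.+-identityʳ _) (ℕ.*-zeroʳ o))
  occSyms-[]-weighted (w ∷ ws) (t ∷ ts) =
    trans (cong₂ _+_ (cong (w ℕ.*_) (occSym-[] t)) (occSyms-[]-weighted ws ts))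
          (rearrange w o (mul h t) (cnt h g t) (sum (zipWith ℕ._*_ ws (muls h ts))) _)
    where
    rearrange : ∀ w o m c ms cs →
      w ℕ.* (o ℕ.* m + c) + (o ℕ.* ms + cs) ≡ o ℕ.* (w ℕ.* m + ms) + (w ℕ.* c + cs)
    rearrange = solve-∀

  -- For each equation both sides count `g` in one and the same term. Without differences the
  -- induction on the list stays in ℕ.
  sum-balance : ∀ {es : List (Equation S n)} → All (λ e → lhs e [ σ ] ≡ rhs e [ σ ]) es →
    o ℕ.* ListAction.sum (List.map (λ e → mul h (lhs e)) es) +
      ListAction.sum (List.map (λ e → cnt h g (lhs e)) es) ≡
    o ℕ.* ListAction.sum (List.map (λ e → mul h (rhs e)) es) +
      ListAction.sum (List.map (λ e → cnt h g (rhs e)) es)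
  sum-balance []                             = refl
  sum-balance {(u ≟F v) ∷ _} (uσ≡vσ ∷ eqs) =
    trans (sym (*+-distrib o (mul h u) (cnt h g u) _ _))
      (trans (cong₂ _+_ balance (sum-balance eqs))
             (*+-distrib o (mul h v) (cnt h g v) _ _))
    where
    balance : o ℕ.* mul h u + cnt h g u ≡ o ℕ.* mul h v + cnt h g v
    balance = trans (sym (occSym-[] u)) (trans (cong (occSym g) uσ≡vσ) (occSym-[] v))

-- The differences may be negative, hence ℤ. Adding and subtracting `c` produces `o * a + c`, which
-- the hypothesis exchanges for `o * b + d`.
*-minus-from-balance : ∀ o a b c d → o ℕ.* a + c ≡ o ℕ.* b + d →
                       + o * (+ a - + b) ≡ + d - + c
*-minus-from-balance o a b c d eq = begin
  + o * (+ a - + b)                         ≡⟨ expand (+ o) (+ a) (+ b) (+ c) ⟩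
  (+ o * + a ℤ.+ + c) - (+ o * + b ℤ.+ + c) ≡⟨ cong (_- (+ o * + b ℤ.+ + c)) eqℤ ⟩
  (+ o * + b ℤ.+ + d) - (+ o * + b ℤ.+ + c) ≡⟨ cancel (+ o * + b) (+ c) (+ d) ⟩
  + d - + c                                 ∎
  where
  open ≡-Reasoning
  expand : ∀ (o a b c : ℤ) → o * (a - b) ≡ (o * a ℤ.+ c) - (o * b ℤ.+ c)
  expand = ℤ-solve-∀
  cancel : ∀ (x c d : ℤ) → (x ℤ.+ d) - (x ℤ.+ c) ≡ d - c
  cancel = ℤ-solve-∀
  pos : ∀ m n k → + (m ℕ.* n + k) ≡ + m * + n ℤ.+ + k
  pos m n k = cong (ℤ._+ + k) (ℤ.pos-* m n)
  eqℤ : + o * + a ℤ.+ + c ≡ + o * + b ℤ.+ + d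
  eqℤ = trans (sym (pos o a c)) (trans (cong +_ eq) (pos o b d))

lemma3p8 : (S : Signature) (n : ℕ) (U : SOGU S n) → Unifiable U →
    (h : Vec ℕ n) (σ : Substitution S n) → IsUnifier U σ →
    VarsAmongParams σ →
    ((i : Fin n) → occVar (lookup (params σ) i) (body σ) ≡ lookup h i) →
    (g : Sym S) →
    + occSym g (body σ) * (+ mulₗ h U - + mulᵣ h U) ≡ + cntᵣ h g U - + cntₗ h g U
lemma3p8 S n U _ h σ unifies _ occ≡h g =
  *-minus-from-balance (occSym g (body σ)) (mulₗ h U) (mulᵣ h U) (cntₗ h g U) (cntᵣ h g U)
    (sum-balance h σ occ≡h g unifies)
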